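{- Let $M\subseteq\mathbb{Z}$ with $1\in M$, let $d$ be a pseudometric on $M$, and let $f_d:M\to\mathbb{R}_{\ge 0}$, $f_d(x)=d(1,x)$. Then the relation $\preceq_d$ on $M$ defined by $$x\preceq_d y \iff f_d(x)\le f_d(y)\qquad(x,y\in M)$$ is a preorder on $M$. If moreover $f_d(x)=f_d(y)\Longrightarrow x=y$ holds for all $x,y\in M$, then $\preceq_d$ is a partial order on $M$.
   Context: A pseudometric on a set $M$ is a function $d:M\times M\to\mathbb{R}$ with $d(x,x)=0$, $d(x,y)=d(y,x)$ and $d(x,z)\le d(x,y)+d(y,z)$ for all $x,y,z\in M$ (so $d\ge 0$). A preorder is a reflexive and transitive relation; a partial order is an antisymmetric preorder. -}

module Defs where

open import Data.Integer using (ℤ; 1ℤ)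
open import Data.Irrelevant using ([_])
open import Data.Nat as ℕ using (ℕ)
import Data.Nat.Properties as ℕ
open import Data.Product using (∃; Σ-syntax; _,_; proj₁)
open import Data.Rational as ℚ using (ℚ; 0ℚ; ½; ∣_∣)
import Data.Rational.Properties as ℚ
open import Data.Rational.Solver using (module +-*-Solver)
open import Data.Refinement using (Refinement; _,_)
open import Data.Sum using (inj₁; inj₂)
open import Function.Metric.Core using (DistanceFunction)
open import Function.Metric.Definitions using (Symmetric; TriangleInequality)
open import Level using (Level)
open import Relation.Binary using (Rel)
open import Relation.Binary.PropositionalEquality
open import Relation.Nullary using (yes; no; contradiction)
open import Relation.Unary using (Pred; _∈_)

private
  variable
    a ℓ : Level

------------------------------------------------------------------------
-- Real numbers as Cauchy sequences of rationals. The quotient by null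
-- sequences is not formed; _≃_ plays the role of equality of reals.

Eventually : Pred ℕ a → Set a
Eventually P = ∃ λ N → ∀ n → N ℕ.≤ n → P n

record ℝ : Set where
  field
    seq    : ℕ → ℚ
    cauchy : ∀ ε → 0ℚ ℚ.< ε →
             ∃ λ N → ∀ m n → N ℕ.≤ m → N ℕ.≤ n → ∣ seq m ℚ.- seq n ∣ ℚ.< ε

open ℝ public

infix 4 _≃_ _≤_
infixl 6 _+_

_≃_ : Rel ℝ _
x ≃ y = ∀ ε → 0ℚ ℚ.< ε → Eventually λ n → ∣ seq x n ℚ.- seq y n ∣ ℚ.< ε

-- The ε is needed since the terms of the sequences only approximate x and y:
-- representatives of equal reals need not be eventually ordered termwise.
_≤_ : Rel ℝ _
x ≤ y = ∀ ε → 0ℚ ℚ.< ε → Eventually λ n → seq x n ℚ.< seq y n ℚ.+ ε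

private
  half-pos : ∀ {ε} → 0ℚ ℚ.< ε → 0ℚ ℚ.< ½ ℚ.* ε
  half-pos {ε} 0<ε = subst (ℚ._< ½ ℚ.* ε) (ℚ.*-zeroʳ ½) (ℚ.*-monoʳ-<-pos ½ 0<ε)

  halves : ∀ ε → ½ ℚ.* ε ℚ.+ ½ ℚ.* ε ≡ ε
  halves ε = trans (sym (ℚ.*-distribʳ-+ ε ½ ½)) (ℚ.*-identityˡ ε)

0ℝ : ℝ
0ℝ = record
  { seq    = λ _ → 0ℚ
  ; cauchy = λ ε 0<ε → 0 , λ _ _ _ _ → 0<ε
  }

_+_ : ℝ → ℝ → ℝ
seq (x + y) n = seq x n ℚ.+ seq y n
cauchy (x + y) ε 0<ε
  with N₁ , p ← cauchy x (½ ℚ.* ε) (half-pos 0<ε)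
     | N₂ , q ← cauchy y (½ ℚ.* ε) (half-pos 0<ε)
  = N₁ ℕ.⊔ N₂ , λ m n N≤m N≤n → begin-strict
    ∣ (seq x m ℚ.+ seq y m) ℚ.- (seq x n ℚ.+ seq y n) ∣
      ≡⟨ cong ∣_∣ (rearrange (seq x m) (seq y m) (seq x n) (seq y n)) ⟩
    ∣ (seq x m ℚ.- seq x n) ℚ.+ (seq y m ℚ.- seq y n) ∣
      ≤⟨ ℚ.∣p+q∣≤∣p∣+∣q∣ (seq x m ℚ.- seq x n) (seq y m ℚ.- seq y n) ⟩
    ∣ seq x m ℚ.- seq x n ∣ ℚ.+ ∣ seq y m ℚ.- seq y n ∣
      <⟨ ℚ.+-mono-< (p m n (ℕ.m⊔n≤o⇒m≤o N₁ N₂ N≤m) (ℕ.m⊔n≤o⇒m≤o N₁ N₂ N≤n))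
                    (q m n (ℕ.m⊔n≤o⇒n≤o N₁ N₂ N≤m) (ℕ.m⊔n≤o⇒n≤o N₁ N₂ N≤n)) ⟩
    ½ ℚ.* ε ℚ.+ ½ ℚ.* ε
      ≡⟨ halves ε ⟩
    ε ∎
  where
  open ℚ.≤-Reasoning
  rearrange : ∀ a b c d →
              (a ℚ.+ b) ℚ.- (c ℚ.+ d) ≡ (a ℚ.- c) ℚ.+ (b ℚ.- d)
  rearrange = solve 4 (λ a b c d →
    (a :+ b) :- (c :+ d) := (a :- c) :+ (b :- d)) refl
    where open +-*-Solver

ℝ≥0 : Set
ℝ≥0 = Σ[ x ∈ ℝ ] 0ℝ ≤ x

infix 4 _≃⁺_ _≤⁺_

_≃⁺_ : Rel ℝ≥0 _
x ≃⁺ y = proj₁ x ≃ proj₁ y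

_≤⁺_ : Rel ℝ≥0 _
x ≤⁺ y = proj₁ x ≤ proj₁ y

------------------------------------------------------------------------
-- Pseudometrics

record IsPseudometric {A : Set a} (d : DistanceFunction A ℝ) : Set a where
  field
    self-zero : ∀ x → d x x ≃ 0ℝ
    symmetric : Symmetric _≃_ d
    triangle  : TriangleInequality _≤_ _+_ d

private
  p≤∣p∣ : ∀ p → p ℚ.≤ ∣ p ∣
  p≤∣p∣ p with ℚ.≤-total 0ℚ p
  ... | inj₁ 0≤p = ℚ.≤-reflexive (sym (ℚ.0≤p⇒∣p∣≡p 0≤p))
  ... | inj₂ p≤0 = ℚ.≤-trans p≤0 (ℚ.0≤∣p∣ p)

  ∣p-q∣<ε⇒q<p+ε : ∀ p q {ε} → ∣ p ℚ.- q ∣ ℚ.< ε → q ℚ.< p ℚ.+ ε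
  ∣p-q∣<ε⇒q<p+ε p q {ε} h = begin-strict
    q                    ≡⟨ lem p q ⟩
    p ℚ.+ ℚ.- (p ℚ.- q)  ≤⟨ ℚ.+-monoʳ-≤ p (p≤∣p∣ (ℚ.- (p ℚ.- q))) ⟩
    p ℚ.+ ∣ ℚ.- (p ℚ.- q) ∣ ≡⟨ cong (p ℚ.+_) (ℚ.∣-p∣≡∣p∣ (p ℚ.- q)) ⟩
    p ℚ.+ ∣ p ℚ.- q ∣    <⟨ ℚ.+-monoʳ-< p h ⟩
    p ℚ.+ ε              ∎
    where
    open ℚ.≤-Reasoning
    lem : ∀ p q → q ≡ p ℚ.+ ℚ.- (p ℚ.- q)
    lem = solve 2 (λ p q → q := p :+ :- (p :- q)) refl
      where open +-*-Solver

  0<p+p⇒0<p : ∀ p → 0ℚ ℚ.< p ℚ.+ p → 0ℚ ℚ.< p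
  0<p+p⇒0<p p h with 0ℚ ℚ.<? p
  ... | yes 0<p = 0<p
  ... | no  0≮p = contradiction
    (ℚ.<-≤-trans h (ℚ.+-mono-≤ (ℚ.≮⇒≥ 0≮p) (ℚ.≮⇒≥ 0≮p))) (ℚ.<-irrefl refl)

nonNegative : {A : Set a} {d : DistanceFunction A ℝ} → IsPseudometric d →
              ∀ x y → 0ℝ ≤ d x y
nonNegative {d = d} isPseudometric x y ε 0<ε
  with N₁ , p ← IsPseudometric.self-zero isPseudometric x (½ ℚ.* ε) (half-pos 0<ε)
     | N₂ , q ← IsPseudometric.symmetric isPseudometric x y (½ ℚ.* ε) (half-pos 0<ε)
     | N₃ , r ← IsPseudometric.triangle isPseudometric x y x (½ ℚ.* ε) (half-pos 0<ε)
  = N₁ ℕ.⊔ N₂ ℕ.⊔ N₃ , λ n N≤n →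
    let N₁₂≤n = ℕ.m⊔n≤o⇒m≤o (N₁ ℕ.⊔ N₂) N₃ N≤n
    in bound (seq (d x x) n) (seq (d x y) n) (seq (d y x) n)
         (p n (ℕ.m⊔n≤o⇒m≤o N₁ N₂ N₁₂≤n))
         (q n (ℕ.m⊔n≤o⇒n≤o N₁ N₂ N₁₂≤n))
         (r n (ℕ.m⊔n≤o⇒n≤o (N₁ ℕ.⊔ N₂) N₃ N≤n))
  where
  open ℚ.≤-Reasoning
  δ = ½ ℚ.* ε

  regroup : ∀ b δ → (((b ℚ.+ (b ℚ.+ δ)) ℚ.+ δ) ℚ.+ δ) ℚ.+ δ ≡
            (b ℚ.+ (δ ℚ.+ δ)) ℚ.+ (b ℚ.+ (δ ℚ.+ δ))
  regroup = solve 2 (λ b δ → (((b :+ (b :+ δ)) :+ δ) :+ δ) :+ δ :=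
    (b :+ (δ :+ δ)) :+ (b :+ (δ :+ δ))) refl
    where open +-*-Solver

  bound : ∀ a b c → ∣ a ℚ.- 0ℚ ∣ ℚ.< δ → ∣ b ℚ.- c ∣ ℚ.< δ →
          a ℚ.< (b ℚ.+ c) ℚ.+ δ → 0ℚ ℚ.< b ℚ.+ ε
  bound a b c a≈0 b≈c a<b+c = 0<p+p⇒0<p (b ℚ.+ ε) (begin-strict
    0ℚ
      <⟨ ∣p-q∣<ε⇒q<p+ε a 0ℚ a≈0 ⟩
    a ℚ.+ δ
      <⟨ ℚ.+-monoˡ-< δ a<b+c ⟩
    ((b ℚ.+ c) ℚ.+ δ) ℚ.+ δ
      <⟨ ℚ.+-monoˡ-< δ (ℚ.+-monoˡ-< δ (ℚ.+-monoʳ-< b (∣p-q∣<ε⇒q<p+ε b c b≈c))) ⟩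
    ((b ℚ.+ (b ℚ.+ δ)) ℚ.+ δ) ℚ.+ δ
      ≡⟨ ℚ.+-identityʳ _ ⟨
    (((b ℚ.+ (b ℚ.+ δ)) ℚ.+ δ) ℚ.+ δ) ℚ.+ 0ℚ
      <⟨ ℚ.+-monoʳ-< (((b ℚ.+ (b ℚ.+ δ)) ℚ.+ δ) ℚ.+ δ) (half-pos 0<ε) ⟩
    (((b ℚ.+ (b ℚ.+ δ)) ℚ.+ δ) ℚ.+ δ) ℚ.+ δ
      ≡⟨ regroup b δ ⟩
    (b ℚ.+ (δ ℚ.+ δ)) ℚ.+ (b ℚ.+ (δ ℚ.+ δ))
      ≡⟨ cong (λ e → (b ℚ.+ e) ℚ.+ (b ℚ.+ e)) (halves ε) ⟩
    (b ℚ.+ ε) ℚ.+ (b ℚ.+ ε) ∎)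

------------------------------------------------------------------------
-- The relation induced by a pseudometric on a set of integers

-- Membership proofs are irrelevant, so _≡_ on Elements M is equality of the
-- underlying integers.
Elements : Pred ℤ ℓ → Set ℓ
Elements M = Refinement ℤ M

module Induced (M : Pred ℤ ℓ) (1∈M : 1ℤ ∈ M)
               (d : DistanceFunction (Elements M) ℝ)
               (isPseudometric : IsPseudometric d) where

  f : Elements M → ℝ≥0
  f x = d one x , nonNegative isPseudometric one x
    where
    one : Elements M
    one = 1ℤ , [ 1∈M ]

  infix 4 _≼_

  _≼_ : Rel (Elements M) _
  x ≼ y = f x ≤⁺ f y

{-# OPTIONS --safe #-}
module Submission where

open import Defs
open import Data.Integer using (ℤ; 1ℤ)
import Data.Nat as ℕ
import Data.Nat.Properties as ℕ
open import Data.Product using (_×_; _,_; proj₁)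
open import Data.Rational as ℚ using (0ℚ; ∣_∣)
import Data.Rational.Properties as ℚ
open import Data.Rational.Solver using (module +-*-Solver)
open import Data.Sum using (inj₁; inj₂)
open import Function.Metric.Core using (DistanceFunction)
open import Relation.Binary.Definitions using (Antisymmetric; Reflexive; Transitive)
open import Relation.Binary.PropositionalEquality
  using (_≡_; refl; sym; subst; isEquivalence)
open import Relation.Binary.Structures using (IsPreorder; IsPartialOrder)
open import Relation.Unary using (Pred; _∈_)

open +-*-Solver
open ℚ.≤-Reasoning

-- The relation `_≼_` is the pullback along `f` of the order on the reals, so it inherits
-- reflexivity and transitivity from `_≤_`. Antisymmetry is inherited only up to equality of
-- distances from 1: `≤-antisym` yields `_≃_` between the values of `f`, and injectivity of `f`
-- turns that into `_≡_` between the elements. What carries the proof is therefore that `_≤_` on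
-- Cauchy sequences is reflexive, transitive and antisymmetric up to `_≃_`, each by an ε-argument on
-- the terms.

p<q⇒0<q-p : ∀ {p q} → p ℚ.< q → 0ℚ ℚ.< q ℚ.- p
p<q⇒0<q-p {p} {q} p<q =
  subst (ℚ._< q ℚ.- p) (ℚ.+-inverseʳ p) (ℚ.+-monoˡ-< (ℚ.- p) p<q)

p<q+ε⇒p-q<ε : ∀ {p q ε} → p ℚ.< q ℚ.+ ε → p ℚ.- q ℚ.< ε
p<q+ε⇒p-q<ε {p} {q} {ε} p<q+ε = begin-strict
  p ℚ.- q          <⟨ ℚ.+-monoˡ-< (ℚ.- q) p<q+ε ⟩
  q ℚ.+ ε ℚ.- q    ≡⟨ solve 2 (λ q ε → q :+ ε :- q := ε) refl q ε ⟩
  ε                ∎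

≤-refl : Reflexive _≤_
≤-refl {x} ε 0<ε = 0 , λ n _ →
  subst (ℚ._< seq x n ℚ.+ ε) (ℚ.+-identityʳ (seq x n)) (ℚ.+-monoʳ-< (seq x n) 0<ε)

≤-trans : Transitive _≤_
≤-trans {x} {y} {z} x≤y y≤z ε 0<ε
  -- Any `δ` strictly between 0 and `ε` splits the tolerance into two positive parts, `δ` and
  -- `ε - δ`, one for each hypothesis.
  with δ , 0<δ , δ<ε ← ℚ.<-dense 0<ε
  with N₁ , p ← x≤y δ 0<δ
     | N₂ , q ← y≤z (ε ℚ.- δ) (p<q⇒0<q-p δ<ε)
  = N₁ ℕ.⊔ N₂ , λ n N≤n → begin-strict
    seq x n
      <⟨ p n (ℕ.m⊔n≤o⇒m≤o N₁ N₂ N≤n) ⟩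
    seq y n ℚ.+ δ
      <⟨ ℚ.+-monoˡ-< δ (q n (ℕ.m⊔n≤o⇒n≤o N₁ N₂ N≤n)) ⟩
    seq z n ℚ.+ (ε ℚ.- δ) ℚ.+ δ
      ≡⟨ solve 3 (λ r ε δ → r :+ (ε :- δ) :+ δ := r :+ ε) refl (seq z n) ε δ ⟩
    seq z n ℚ.+ ε ∎

-- For given `ε` the two hypotheses bound the difference of the terms and its negative by the same
-- `ε`, and the absolute value is one of these two, so `ε` need not be split.
≤-antisym : Antisymmetric _≃_ _≤_
≤-antisym {x} {y} x≤y y≤x ε 0<ε
  with N₁ , p ← x≤y ε 0<ε
     | N₂ , q ← y≤x ε 0<ε
  = N₁ ℕ.⊔ N₂ , λ n N≤n →
    bound (seq x n) (seq y n)
      (p n (ℕ.m⊔n≤o⇒m≤o N₁ N₂ N≤n)) (q n (ℕ.m⊔n≤o⇒n≤o N₁ N₂ N≤n))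
  where
  bound : ∀ a b → a ℚ.< b ℚ.+ ε → b ℚ.< a ℚ.+ ε → ∣ a ℚ.- b ∣ ℚ.< ε
  bound a b a<b+ε b<a+ε with ℚ.∣p∣≡p∨∣p∣≡-p (a ℚ.- b)
  ... | inj₁ eq = subst (ℚ._< ε) (sym eq) (p<q+ε⇒p-q<ε a<b+ε)
  ... | inj₂ eq = begin-strict
    ∣ a ℚ.- b ∣      ≡⟨ eq ⟩
    ℚ.- (a ℚ.- b)    ≡⟨ solve 2 (λ a b → :- (a :- b) := b :- a) refl a b ⟩
    b ℚ.- a          <⟨ p<q+ε⇒p-q<ε b<a+ε ⟩
    ε                ∎

lemma1p3 : ∀ {ℓ} (M : Pred ℤ ℓ) (1∈M : 1ℤ ∈ M)
    (d : DistanceFunction (Elements M) ℝ)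
    (isPseudometric : IsPseudometric d) →
    let open Induced M 1∈M d isPseudometric in
    IsPreorder _≡_ _≼_ ×
    ((∀ x y → f x ≃⁺ f y → x ≡ y) → IsPartialOrder _≡_ _≼_)
lemma1p3 M 1∈M d isPseudometric = isPreorder , λ f-injective → record
  { isPreorder = isPreorder
  ; antisym    = λ {x} {y} x≼y y≼x →
      f-injective x y (≤-antisym {dist x} {dist y} x≼y y≼x)
  }
  where
  open Induced M 1∈M d isPseudometric

  -- Names the reals to be passed explicitly below: `_≤_` unfolds to a statement about the terms
  -- `seq`, from which the real itself, with its Cauchy proof, cannot be inferred.
  dist : Elements M → ℝ
  dist x = proj₁ (f x)

  isPreorder : IsPreorder _≡_ _≼_
  isPreorder = record
    { isEquivalence = isEquivalence
    ; reflexive     = λ { {x} refl → ≤-refl {dist x} }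
    ; trans         = λ {x} {y} {z} → ≤-trans {dist x} {dist y} {dist z}
    }
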